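{- For every integer $k\ge 1$ there exists a $4$-pass catalytic streaming algorithm which, on every insertion-only stream $\mathcal S=\langle x_1,\dots,x_m\rangle$ with items in $[n]$, computes the $k$-th frequency moment $F_k(\mathcal S)=\sum_{i=1}^n f_i^k$ exactly, using $O(k\log m)$ bits of clean space and $O(k^2 n\log m)$ bits of catalytic space.
   Context: A stream is a sequence $\mathcal S=\langle x_1,\dots,x_m\rangle$ with $x_i\in[n]=\{1,\dots,n\}$; $f_i$ is the number of occurrences of $i$ in the stream. The length $m$ is known to the algorithm in advance and $m\ge n$. Catalytic streaming model: an algorithm has read-only access to the stream, which it scans sequentially from beginning to end in each pass; a workspace ("clean space") initialized to all zeros; and a catalytic memory initially containing an arbitrary string $z$. The algorithm may read and modify the catalytic memory during the computation but must restore it to exactly $z$ at the end. It computes a function $g$ if for every stream $\mathcal S$ and every initial catalytic content $z$ it outputs $g(\mathcal S)$ and terminates with catalytic content exactly $z$. Clean space and catalytic space are measured in bits. Space complexity refers to storage space (memory maintained between arrivals of consecutive stream items), not to the temporary memory used while processing a single item. -}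

module Defs where

open import Data.Bool.Base using (Bool; false)
open import Data.Fin.Base using (Fin)
open import Data.Fin.Properties using (_≟_)
open import Data.Nat.Base using (ℕ; _^_)
open import Data.Nat.GeneralisedArithmetic using (iterate)
open import Data.Product.Base using (_×_; _,_; proj₂)
open import Data.Vec.Base using (Vec; count; foldl′; replicate; sum; tabulate)
open import Relation.Binary.PropositionalEquality.Core using (_≡_)

Stream : ℕ → ℕ → Set
Stream n m = Vec (Fin n) m

frequency : ∀ {n m} → Stream n m → Fin n → ℕ
frequency xs i = count (i ≟_) xs

frequencyMoment : ∀ {n m} → ℕ → Stream n m → ℕ
frequencyMoment k xs = sum (tabulate λ i → frequency xs i ^ k)

Bits : ℕ → Set
Bits = Vec Bool

-- Space is storage space: a configuration is everything that survives from one
-- stream item to the next.  In particular the transition functions receive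
-- neither the number of the current pass nor the position in the stream, so
-- these must be kept in memory if they are needed.  Work done while handling a
-- single event (an item, or the end of a pass) is not charged, so transitions
-- are arbitrary functions.
record CatalyticAlgorithm (n : ℕ) : Set where
  field
    cleanBits     : ℕ
    catalyticBits : ℕ

  Config : Set
  Config = Bits cleanBits × Bits catalyticBits

  field
    onItem      : Fin n → Config → Config
    onEndOfPass : Config → Config
    output      : Config → ℕ

  initial : Bits catalyticBits → Config
  initial z = replicate cleanBits false , z

  runPass : ∀ {m} → Stream n m → Config → Config
  runPass xs c = onEndOfPass (foldl′ (λ c′ x → onItem x c′) c xs)

  run : ∀ {m} → ℕ → Stream n m → Bits catalyticBits → Config
  run passes xs z = iterate (runPass xs) (initial z) passes

open CatalyticAlgorithm

Computes : ∀ {n m} → CatalyticAlgorithm n → (passes : ℕ) → (Stream n m → ℕ) → Set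
Computes A passes g = ∀ xs z →
  output A (run A passes xs z) ≡ g xs × proj₂ (run A passes xs z) ≡ z

{-# OPTIONS --safe #-}
-- Each item i owns a register v ∈ Gᵏ⁺¹ over the group G = ℤ/2ᵇ, and every
-- occurrence of i applies to it either the binomial transform B or B⁻¹.  Since
-- B sends (xʲ)ⱼ to ((x+1)ʲ)ⱼ, the sequence "f times B⁻¹, add (0ʲ)ⱼ, f times B"
-- turns an arbitrary v into v + (fʲ)ⱼ by linearity.  So after two passes the sum
-- of the last coordinates has grown by exactly F_k, whatever the registers
-- contained; the two remaining passes undo the change, after which the original
-- sum is available and can be subtracted.
module Submission where

open import Defs
open import Data.Nat.Base using (ℕ; _*_; _≤_)
open import Data.Nat.Logarithm using (⌊log₂_⌋)
open import Data.Product.Base using (_×_; ∃-syntax; Σ-syntax)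
open CatalyticAlgorithm using (cleanBits; catalyticBits)

open import Algebra.Bundles using (AbelianGroup)
open import Algebra.Structures using (IsAbelianGroup)
import Algebra.Consequences.Propositional as Consequences
import Algebra.Properties.CommutativeMonoid.Mult as Mult
import Algebra.Properties.CommutativeMonoid.Sum as Sum
import Algebra.Properties.CommutativeSemigroup as CommutativeSemigroup
import Algebra.Properties.Group as GroupProperties
open import Data.Bool.Base using (Bool; true; false)
open import Data.Fin.Base using (Fin; zero; suc; toℕ)
open import Data.Fin.Properties using (_≟_; toℕ-injective; toℕ<n; toℕ-fromℕ<; *↔×; 2↔Bool)
open import Data.Nat.Base using (zero; suc; _+_; _∸_; _^_; _<_; NonZero; z≤n; s≤s)
open import Data.Nat.DivMod
  using (_%_; _mod_; %-distribˡ-+; m*n%n≡0; n%n≡0; m<n⇒m%n≡m; m%n<n)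
open import Data.Nat.GeneralisedArithmetic using (iterate)
open import Data.Nat.Logarithm using (⌊log₂⌋-mono-≤; ⌊log₂[2^n]⌋≡n)
open import Data.Nat.Properties
  using ( +-comm; +-assoc; +-identityʳ; +-mono-≤; +-monoˡ-≤; *-comm; *-mono-≤; *-monoˡ-≤; *-monoʳ-≤
        ; ^-monoˡ-≤; ^-monoˡ-<; ^-*-assoc; ^-zeroˡ; m^n≢0; m+[n∸m]≡n; m≤m+n; <⇒≤; ≰⇒>; 1+n≰n
        ; module ≤-Reasoning)
open import Data.Nat.Tactic.RingSolver using (solve-∀)
open import Data.Product.Base using (_,_; proj₁; proj₂; uncurry)
open import Data.Product.Function.NonDependent.Propositional using (_×-↔_)
open import Data.Vec.Base
  using ( Vec; []; _∷_; concat; foldl′; group; head; last; lookup; map; replicate; sum; tabulate; uncons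
        ; updateAt; zipWith)
open import Data.Vec.Properties
  using ( count≤n; lookup-map; lookup∘updateAt; lookup∘updateAt′; map-cong; map-id; map-∘
        ; tabulate-cong; tabulate∘lookup; ++-injectiveˡ; ++-injectiveʳ)
open import Function.Base using (_∘_)
open import Function.Bundles using (Inverse; _↔_; mk↔ₛ′)
open import Function.Construct.Composition using (_↔-∘_)
open import Function.Construct.Symmetry using (↔-sym)
open import Level using (0ℓ)
open import Relation.Binary.PropositionalEquality
open import Relation.Nullary using (yes; no)

private
  variable
    A B : Set
    b k m n : ℕ

-- Iteration, vectors and bijective encodings.

iterate-suc : ∀ (f : A → A) c x → iterate f (f x) c ≡ f (iterate f x c)
iterate-suc f zero    x = refl
iterate-suc f (suc c) x = iterate-suc f c (f x)

iterate-cancel : {g h : A → A} → (∀ x → g (h x) ≡ x) →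
                 ∀ c x → iterate g (iterate h x c) c ≡ x
iterate-cancel                 gh zero    x = refl
iterate-cancel {g = g} {h = h} gh (suc c) x
  rewrite iterate-suc h c x | gh (iterate h x c) = iterate-cancel gh c x

lookup-injective : {xs ys : Vec A n} → (∀ i → lookup xs i ≡ lookup ys i) → xs ≡ ys
lookup-injective {xs = xs} {ys} eq =
  trans (sym (tabulate∘lookup xs)) (trans (tabulate-cong eq) (tabulate∘lookup ys))

last-zipWith : ∀ (f : A → A → A) (u v : Vec A (suc n)) →
               last (zipWith f u v) ≡ f (last u) (last v)
last-zipWith f (x ∷ [])     (y ∷ [])     = refl
last-zipWith f (x ∷ x′ ∷ u) (y ∷ y′ ∷ v) = last-zipWith f (x′ ∷ u) (y′ ∷ v)

concat-injective : (u v : Vec (Vec A m) n) → concat u ≡ concat v → u ≡ v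
concat-injective []      []      eq = refl
concat-injective (x ∷ u) (y ∷ v) eq =
  cong₂ _∷_ (++-injectiveˡ x y eq) (concat-injective u v (++-injectiveʳ x y eq))

-- `group` comes only with a proof that concatenating its blocks gives back the input; injectivity
-- of `concat` supplies the other inverse law.
group↔ : Vec A (n * m) ↔ Vec (Vec A m) n
group↔ {n = n} {m} = mk↔ₛ′ (λ v → proj₁ (group n m v)) concat
  (λ v → concat-injective _ _ (sym (proj₂ (group n m (concat v)))))
  (λ v → sym (proj₂ (group n m v)))

map↔ : A ↔ B → Vec A n ↔ Vec B n
map↔ A↔B = mk↔ₛ′ (map to) (map from)
  (λ v → trans (sym (map-∘ to from v)) (trans (map-cong strictlyInverseˡ v) (map-id v)))
  (λ v → trans (sym (map-∘ from to v)) (trans (map-cong strictlyInverseʳ v) (map-id v)))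
  where open Inverse A↔B

uncons↔ : Vec A (suc n) ↔ (A × Vec A n)
uncons↔ = mk↔ₛ′ uncons (uncurry _∷_) (λ _ → refl) (λ { (_ ∷ _) → refl })

-- With a power of two as modulus, every string of `b` bits is a group element, so no catalytic
-- content is an invalid code.
bits↔Fin : ∀ b → Bits b ↔ Fin (2 ^ b)
bits↔Fin zero    = mk↔ₛ′ (λ _ → zero) (λ _ → []) (λ { zero → refl }) (λ { [] → refl })
bits↔Fin (suc b) = ↔-sym *↔× ↔-∘ ((↔-sym 2↔Bool ×-↔ bits↔Fin b) ↔-∘ uncons↔)

-- The effect of one pass on the registers.

sweep : (A → A) → Stream n m → Vec A n → Vec A n
sweep g xs v = foldl′ (λ u x → updateAt u x g) v xs

-- An item touches its own register only, so the order of the stream is lost and only the number of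
-- occurrences remains.
lookup-sweep : ∀ (g : A → A) (xs : Stream n m) v i →
               lookup (sweep g xs v) i ≡ iterate g (lookup v i) (frequency xs i)
lookup-sweep g []       v i = refl
lookup-sweep g (x ∷ xs) v i with i ≟ x | lookup-sweep g xs (updateAt v x g) i
... | yes refl | ih = trans ih (cong (λ r → iterate g r (frequency xs i)) (lookup∘updateAt i v))
... | no i≢x   | ih = trans ih (cong (λ r → iterate g r (frequency xs i)) (lookup∘updateAt′ i x i≢x v))

-- Both sweeps read the stream in the same direction. They still cancel because each register
-- undergoes equally many applications of `h` and then of `g`.
sweep-cancel : {g h : A → A} → (∀ r → g (h r) ≡ r) →
               ∀ (xs : Stream n m) v → sweep g xs (sweep h xs v) ≡ v
sweep-cancel {g = g} {h} gh xs v = lookup-injective λ i → begin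
  lookup (sweep g xs (sweep h xs v)) i        ≡⟨ lookup-sweep g xs (sweep h xs v) i ⟩
  iterate g (lookup (sweep h xs v) i) (f i)   ≡⟨ cong (λ r → iterate g r (f i)) (lookup-sweep h xs v i) ⟩
  iterate g (iterate h (lookup v i) (f i)) (f i) ≡⟨ iterate-cancel gh (f i) (lookup v i) ⟩
  lookup v i                                  ∎
  where
  open ≡-Reasoning
  f = frequency xs

-- The binomial transform over an abelian group.

module Registers {G : Set} {_⊕_ : G → G → G} {0# : G} {⊖_ : G → G}
                 (isAbelianGroup : IsAbelianGroup _≡_ _⊕_ 0# ⊖_) (one : G) where

  abelianGroup : AbelianGroup 0ℓ 0ℓ
  abelianGroup = record { isAbelianGroup = isAbelianGroup }

  open AbelianGroup abelianGroup
    using (identityʳ; commutativeMonoid; commutativeSemigroup)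
  open GroupProperties (AbelianGroup.group abelianGroup) using (\\-leftDividesˡ; \\-leftDividesʳ; //-rightDividesʳ)
  open CommutativeSemigroup commutativeSemigroup using (interchange)
  open Mult commutativeMonoid public using () renaming (_×_ to _·_)
  open Mult commutativeMonoid using (×-assocˡ; ×-homo-+)
  open Sum commutativeMonoid using (∑-distrib-+; sum-cong-≗) renaming (sum to ∑)
  open ≡-Reasoning

  infixl 6 _⊞_

  _⊞_ : Vec G n → Vec G n → Vec G n
  _⊞_ = zipWith _⊕_

  ⊞-cancelˡ : (u v : Vec G n) → map ⊖_ u ⊞ (u ⊞ v) ≡ v
  ⊞-cancelˡ []      []      = refl
  ⊞-cancelˡ (x ∷ u) (y ∷ v) = cong₂ _∷_ (\\-leftDividesʳ x y) (⊞-cancelˡ u v)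

  neighbourSums : Vec G (suc n) → Vec G n
  neighbourSums (x ∷ [])    = []
  neighbourSums (x ∷ y ∷ v) = (x ⊕ y) ∷ neighbourSums (y ∷ v)

  -- Neighbour sums determine a vector only once its first coordinate is known, which is therefore
  -- an argument here.
  fromNeighbourSums : G → Vec G n → Vec G (suc n)
  fromNeighbourSums x []      = x ∷ []
  fromNeighbourSums x (s ∷ v) = x ∷ fromNeighbourSums ((⊖ x) ⊕ s) v

  neighbourSums-from : ∀ x (v : Vec G n) → neighbourSums (fromNeighbourSums x v) ≡ v
  neighbourSums-from x []          = refl
  neighbourSums-from x (s ∷ [])    = cong (_∷ []) (\\-leftDividesˡ x s)
  neighbourSums-from x (s ∷ t ∷ v) = cong₂ _∷_ (\\-leftDividesˡ x s) (neighbourSums-from ((⊖ x) ⊕ s) (t ∷ v))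

  from-neighbourSums : ∀ (v : Vec G (suc n)) → fromNeighbourSums (head v) (neighbourSums v) ≡ v
  from-neighbourSums (x ∷ [])    = refl
  from-neighbourSums (x ∷ y ∷ v) = cong (x ∷_)
    (trans (cong (λ z → fromNeighbourSums z (neighbourSums (y ∷ v))) (\\-leftDividesʳ x y))
           (from-neighbourSums (y ∷ v)))

  head-from : ∀ x (v : Vec G n) → head (fromNeighbourSums x v) ≡ x
  head-from x []      = refl
  head-from x (_ ∷ _) = refl

  -- (binomial v)ⱼ = Σᵢ (j choose i) vᵢ, computed by Pascal's rule.
  binomial : Vec G n → Vec G n
  binomial {zero}  v = []
  binomial {suc n} v = head v ∷ binomial (neighbourSums v)

  binomial⁻¹ : Vec G n → Vec G n
  binomial⁻¹ []      = []
  binomial⁻¹ (x ∷ v) = fromNeighbourSums x (binomial⁻¹ v)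

  binomial-binomial⁻¹ : (v : Vec G n) → binomial (binomial⁻¹ v) ≡ v
  binomial-binomial⁻¹ []      = refl
  binomial-binomial⁻¹ (x ∷ v) = cong₂ _∷_ (head-from x (binomial⁻¹ v))
    (trans (cong binomial (neighbourSums-from x (binomial⁻¹ v))) (binomial-binomial⁻¹ v))

  binomial⁻¹-binomial : (v : Vec G n) → binomial⁻¹ (binomial v) ≡ v
  binomial⁻¹-binomial {zero}  [] = refl
  binomial⁻¹-binomial {suc n} v  =
    trans (cong (fromNeighbourSums (head v)) (binomial⁻¹-binomial (neighbourSums v)))
          (from-neighbourSums v)

  neighbourSums-⊞ : (u v : Vec G (suc n)) → neighbourSums (u ⊞ v) ≡ neighbourSums u ⊞ neighbourSums v
  neighbourSums-⊞ (x ∷ [])     (y ∷ [])     = refl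
  neighbourSums-⊞ (x ∷ x′ ∷ u) (y ∷ y′ ∷ v) =
    cong₂ _∷_ (interchange x y x′ y′) (neighbourSums-⊞ (x′ ∷ u) (y′ ∷ v))

  -- Each application of Pascal's rule is additive. This is what separates the kick from the unknown
  -- register content.
  binomial-⊞ : (u v : Vec G n) → binomial (u ⊞ v) ≡ binomial u ⊞ binomial v
  binomial-⊞ {zero}  []        []        = refl
  binomial-⊞ {suc n} u@(_ ∷ _) v@(_ ∷ _) = cong (_ ∷_)
    (trans (cong binomial (neighbourSums-⊞ u v)) (binomial-⊞ (neighbourSums u) (neighbourSums v)))

  iterate-binomial-⊞ : ∀ c (u v : Vec G n) →
    iterate binomial (u ⊞ v) c ≡ iterate binomial u c ⊞ iterate binomial v c
  iterate-binomial-⊞ zero    u v = refl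
  iterate-binomial-⊞ (suc c) u v =
    trans (cong (λ w → iterate binomial w c) (binomial-⊞ u v))
          (iterate-binomial-⊞ c (binomial u) (binomial v))

  -- The initial term is left free because taking neighbour sums changes it while keeping the ratio.
  -- For ratio 0 the convention is 0⁰ = 1.
  geometric : ∀ n → ℕ → G → Vec G n
  geometric zero    x g = []
  geometric (suc n) x g = g ∷ geometric n x (x · g)

  ·-comm : ∀ x y g → x · (y · g) ≡ y · (x · g)
  ·-comm x y g = trans (×-assocˡ g x y) (trans (cong (_· g) (*-comm x y)) (sym (×-assocˡ g y x)))

  -- Because xʲ + xʲ⁺¹ = (1 + x) xʲ.
  neighbourSums-geometric : ∀ n x g → neighbourSums (geometric (suc n) x g) ≡ geometric n x (suc x · g)
  neighbourSums-geometric zero    x g = refl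
  neighbourSums-geometric (suc n) x g = cong ((suc x · g) ∷_)
    (trans (neighbourSums-geometric n x (x · g)) (cong (geometric n x) (·-comm (suc x) x g)))

  -- The binomial theorem. The tail is the transform of a progression with ratio `x` and initial
  -- term `suc x · g`; by induction its ratio becomes `suc x`, so it continues the progression begun
  -- by `g`.
  binomial-geometric : ∀ n x g → binomial (geometric n x g) ≡ geometric n (suc x) g
  binomial-geometric zero    x g = refl
  binomial-geometric (suc n) x g = cong (g ∷_)
    (trans (cong binomial (neighbourSums-geometric n x g)) (binomial-geometric n x (suc x · g)))

  iterate-binomial-geometric : ∀ c x g → iterate binomial (geometric n x g) c ≡ geometric n (c + x) g
  iterate-binomial-geometric         zero    x g = refl
  iterate-binomial-geometric {n = n} (suc c) x g =
    trans (iterate-suc binomial c (geometric n x g))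
          (trans (cong binomial (iterate-binomial-geometric c x g)) (binomial-geometric n (c + x) g))

  last-geometric : ∀ k x g → last (geometric (suc k) x g) ≡ (x ^ k) · g
  last-geometric zero    x g = sym (identityʳ g)
  last-geometric (suc k) x g = begin
    last (geometric (suc k) x (x · g)) ≡⟨ last-geometric k x (x · g) ⟩
    (x ^ k) · (x · g)                  ≡⟨ ×-assocˡ g (x ^ k) x ⟩
    (x ^ k * x) · g                    ≡⟨ cong (_· g) (*-comm (x ^ k) x) ⟩
    (x ^ suc k) · g                    ∎

  -- The moment as a change of the readout.

  Memory : ℕ → ℕ → Set
  Memory n k = Vec (Vec G (suc k)) n

  -- With ratio 0, `one` is added to the first coordinate of every register. If an item never
  -- occurs, the last coordinate of its register thereby grows by 0ᵏ, exactly its term in the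
  -- moment.
  kick : Memory n k → Memory n k
  kick = map (geometric _ 0 one ⊞_)

  unkick : Memory n k → Memory n k
  unkick = map (map ⊖_ (geometric _ 0 one) ⊞_)

  unkick-kick : (v : Memory n k) → unkick (kick v) ≡ v
  unkick-kick v = trans (sym (map-∘ _ _ v)) (trans (map-cong (⊞-cancelˡ _) v) (map-id v))

  readout : Memory n k → G
  readout v = ∑ (λ i → last (lookup v i))

  ∑-· : ∀ (f : Fin n → ℕ) g → ∑ (λ i → f i · g) ≡ sum (tabulate f) · g
  ∑-· {zero}  f g = refl
  ∑-· {suc n} f g = trans (cong ((f zero · g) ⊕_) (∑-· (f ∘ suc) g))
                          (sym (×-homo-+ g (f zero) (sum (tabulate (f ∘ suc)))))

  transform : Stream n m → Memory n k → Memory n k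
  transform xs v = sweep binomial xs (kick (sweep binomial⁻¹ xs v))

  -- The third pass undoes the second, and `unkick` then undoes the end of the first. What is left
  -- is the memory before the kick, which the fourth pass turns back into `v`.
  unkick-transform : ∀ (xs : Stream n m) (v : Memory n k) →
    unkick (sweep binomial⁻¹ xs (transform xs v)) ≡ sweep binomial⁻¹ xs v
  unkick-transform xs v =
    trans (cong unkick (sweep-cancel binomial⁻¹-binomial xs (kick (sweep binomial⁻¹ xs v))))
          (unkick-kick (sweep binomial⁻¹ xs v))

  lookup-transform : ∀ (xs : Stream n m) (v : Memory n k) i →
    lookup (transform xs v) i ≡ geometric (suc k) (frequency xs i + 0) one ⊞ lookup v i
  lookup-transform {k = k} xs v i = begin
    lookup (transform xs v) i
      ≡⟨ lookup-sweep binomial xs _ i ⟩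
    iterate binomial (lookup (kick (sweep binomial⁻¹ xs v)) i) f
      ≡⟨ cong (λ r → iterate binomial r f) (lookup-map i _ (sweep binomial⁻¹ xs v)) ⟩
    iterate binomial (r₀ ⊞ lookup (sweep binomial⁻¹ xs v) i) f
      ≡⟨ cong (λ r → iterate binomial (r₀ ⊞ r) f) (lookup-sweep binomial⁻¹ xs v i) ⟩
    iterate binomial (r₀ ⊞ iterate binomial⁻¹ (lookup v i) f) f
      ≡⟨ iterate-binomial-⊞ f r₀ _ ⟩
    iterate binomial r₀ f ⊞ iterate binomial (iterate binomial⁻¹ (lookup v i) f) f
      -- The kick advances from ratio 0 to ratio `f + 0`, while the old content comes back.
      ≡⟨ cong₂ _⊞_ (iterate-binomial-geometric f 0 one)
                   (iterate-cancel binomial-binomial⁻¹ f (lookup v i)) ⟩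
    geometric (suc k) (f + 0) one ⊞ lookup v i ∎
    where
    f  = frequency xs i
    r₀ = geometric (suc k) 0 one

  readout-transform : ∀ (xs : Stream n m) (v : Memory n k) →
    readout (transform xs v) ≡ (frequencyMoment k xs · one) ⊕ readout v
  readout-transform {k = k} xs v = begin
    readout (transform xs v)
      ≡⟨ sum-cong-≗ (λ i → trans (cong last (lookup-transform xs v i))
                                 (last-zipWith _⊕_ (geometric (suc k) (f i + 0) one) (lookup v i))) ⟩
    ∑ (λ i → last (geometric (suc k) (f i + 0) one) ⊕ last (lookup v i))
      ≡⟨ ∑-distrib-+ (λ i → last (geometric (suc k) (f i + 0) one)) (λ i → last (lookup v i)) ⟩
    ∑ (λ i → last (geometric (suc k) (f i + 0) one)) ⊕ readout v
      ≡⟨ cong (_⊕ readout v) (sum-cong-≗ λ i →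
           -- After commuting, `0 + f i` reduces to `f i`.
           trans (last-geometric k (f i + 0) one) (cong (λ x → (x ^ k) · one) (+-comm (f i) 0))) ⟩
    ∑ (λ i → (f i ^ k) · one) ⊕ readout v
      ≡⟨ cong (_⊕ readout v) (∑-· (λ i → f i ^ k) one) ⟩
    (frequencyMoment k xs · one) ⊕ readout v ∎
    where f = frequency xs

  -- The four-pass algorithm on bit strings.

  module Algorithm (code : Bits b ↔ G) (value : G → ℕ) (n k : ℕ) where

    open Inverse code using () renaming
      (to to decodeWord; from to encodeWord; strictlyInverseˡ to decode-encodeWord)

    -- Both inverse laws matter: updated registers must be storable without loss, and restoring the
    -- registers must restore the very bits of the initial string.
    memory↔ : Bits (n * (suc k * b)) ↔ Memory n k
    memory↔ = map↔ (map↔ code ↔-∘ group↔) ↔-∘ group↔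

    open Inverse memory↔ using () renaming
      (to to decode; from to encode; strictlyInverseˡ to decode-encode; strictlyInverseʳ to encode-decode)

    -- The argument is the low counter bit: the first and third passes apply the inverse, the second
    -- and fourth the transform.
    step : Bool → Vec G (suc k) → Vec G (suc k)
    step false = binomial⁻¹
    step true  = binomial

    State : Set
    State = Bits (2 + b) × Bits (n * (suc k * b))

    -- The first two clean bits are the pass counter, least significant bit first.
    onItem : Fin n → State → State
    onItem x (p ∷ q ∷ w , z) = p ∷ q ∷ w , encode (updateAt (decode z) x (step p))

    onEndOfPass : State → State
    onEndOfPass (false ∷ false ∷ w , z) = true  ∷ false ∷ w , encode (kick (decode z))
    -- The saved sum is the moment plus the sum over the initial registers, which is still unknown.
    onEndOfPass (true  ∷ false ∷ w , z) = false ∷ true  ∷ encodeWord (readout (decode z)) , z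
    onEndOfPass (false ∷ true  ∷ w , z) = true  ∷ true  ∷ w , encode (unkick (decode z))
    -- The fourth sweep has just restored the initial registers, so their sum can be read off and
    -- subtracted.
    onEndOfPass (true  ∷ true  ∷ w , z) =
      false ∷ false ∷ encodeWord (decodeWord w ⊕ (⊖ readout (decode z))) , z

    output : State → ℕ
    output (_ ∷ _ ∷ w , _) = value (decodeWord w)

    algorithm : CatalyticAlgorithm n
    algorithm = record
      { cleanBits     = 2 + b
      ; catalyticBits = n * (suc k * b)
      ; onItem        = onItem
      ; onEndOfPass   = onEndOfPass
      ; output        = output
      }

    open CatalyticAlgorithm algorithm using (runPass; run)

    -- Decoding at one item undoes the encoding at the previous one, so the bit-level pass follows
    -- the sweep of the registers.
    foldl-onItem : ∀ (xs : Stream n m) p q w z →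
      foldl′ (λ c x → onItem x c) (p ∷ q ∷ w , z) xs ≡ (p ∷ q ∷ w , encode (sweep (step p) xs (decode z)))
    foldl-onItem []       p q w z = cong (p ∷ q ∷ w ,_) (sym (encode-decode z))
    foldl-onItem (x ∷ xs) p q w z =
      trans (foldl-onItem xs p q w _)
            (cong (λ v → p ∷ q ∷ w , encode (sweep (step p) xs v)) (decode-encode _))

    runPass-encode : ∀ (xs : Stream n m) p q w v →
      runPass xs (p ∷ q ∷ w , encode v) ≡ onEndOfPass (p ∷ q ∷ w , encode (sweep (step p) xs v))
    runPass-encode xs p q w v = cong onEndOfPass
      (trans (foldl-onItem xs p q w (encode v))
             (cong (λ u → p ∷ q ∷ w , encode (sweep (step p) xs u)) (decode-encode v)))

    pass₁ : ∀ (xs : Stream n m) w v →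
      runPass xs (false ∷ false ∷ w , encode v) ≡ (true ∷ false ∷ w , encode (kick (sweep binomial⁻¹ xs v)))
    pass₁ xs w v = trans (runPass-encode xs false false w v)
      (cong (λ u → true ∷ false ∷ w , encode (kick u)) (decode-encode (sweep binomial⁻¹ xs v)))

    pass₂ : ∀ (xs : Stream n m) w v →
      runPass xs (true ∷ false ∷ w , encode v) ≡
      (false ∷ true ∷ encodeWord (readout (sweep binomial xs v)) , encode (sweep binomial xs v))
    pass₂ xs w v = trans (runPass-encode xs true false w v)
      (cong (λ u → false ∷ true ∷ encodeWord (readout u) , encode (sweep binomial xs v))
            (decode-encode (sweep binomial xs v)))

    pass₃ : ∀ (xs : Stream n m) w v →
      runPass xs (false ∷ true ∷ w , encode v) ≡ (true ∷ true ∷ w , encode (unkick (sweep binomial⁻¹ xs v)))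
    pass₃ xs w v = trans (runPass-encode xs false true w v)
      (cong (λ u → true ∷ true ∷ w , encode (unkick u)) (decode-encode (sweep binomial⁻¹ xs v)))

    pass₄ : ∀ (xs : Stream n m) g v →
      runPass xs (true ∷ true ∷ encodeWord g , encode v) ≡
      (false ∷ false ∷ encodeWord (g ⊕ (⊖ readout (sweep binomial xs v))) , encode (sweep binomial xs v))
    pass₄ xs g v = trans (runPass-encode xs true true (encodeWord g) v)
      (cong₂ (λ h u → false ∷ false ∷ encodeWord (h ⊕ (⊖ readout u)) , encode (sweep binomial xs v))
             (decode-encodeWord g) (decode-encode (sweep binomial xs v)))

    run-encode : ∀ (xs : Stream n m) v →
      run 4 xs (encode v) ≡ (false ∷ false ∷ encodeWord (frequencyMoment k xs · one) , encode v)
    run-encode xs v = begin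
      run 4 xs (encode v)
        -- The all-zero clean space is the counter value of the first pass.
        ≡⟨ cong (pass ∘ pass ∘ pass) (pass₁ xs (replicate b false) v) ⟩
      (pass ∘ pass ∘ pass) (true ∷ false ∷ replicate b false , encode (kick u))
        ≡⟨ cong (pass ∘ pass) (pass₂ xs (replicate b false) (kick u)) ⟩
      (pass ∘ pass) (false ∷ true ∷ encodeWord (readout (transform xs v)) , encode (transform xs v))
        ≡⟨ cong pass (pass₃ xs (encodeWord (readout (transform xs v))) (transform xs v)) ⟩
      pass (true ∷ true ∷ encodeWord (readout (transform xs v)) ,
            encode (unkick (sweep binomial⁻¹ xs (transform xs v))))
        -- The saved word is now split into moment and initial readout, and the registers return to
        -- `u`, their state before the kick.
        ≡⟨ cong₂ (λ g w → pass (true ∷ true ∷ encodeWord g , encode w))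
                 (readout-transform xs v) (unkick-transform xs v) ⟩
      pass (true ∷ true ∷ encodeWord (moment ⊕ readout v) , encode u)
        ≡⟨ pass₄ xs (moment ⊕ readout v) u ⟩
      (false ∷ false ∷ encodeWord ((moment ⊕ readout v) ⊕ (⊖ readout (sweep binomial xs u))) ,
       encode (sweep binomial xs u))
        ≡⟨ cong (λ w → false ∷ false ∷ encodeWord ((moment ⊕ readout v) ⊕ (⊖ readout w)) , encode w)
                (sweep-cancel binomial-binomial⁻¹ xs v) ⟩
      (false ∷ false ∷ encodeWord ((moment ⊕ readout v) ⊕ (⊖ readout v)) , encode v)
        ≡⟨ cong (λ g → false ∷ false ∷ encodeWord g , encode v) (//-rightDividesʳ (readout v) moment) ⟩
      (false ∷ false ∷ encodeWord moment , encode v) ∎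
      where
      pass   = runPass xs
      moment = frequencyMoment k xs · one
      u      = sweep binomial⁻¹ xs v

    -- The run yields the moment only as a multiple of `one`; the hypothesis says that `value` reads
    -- it back exactly. Any initial string is covered since it equals `encode (decode z)`.
    computes : ∀ m → (∀ (xs : Stream n m) → value (frequencyMoment k xs · one) ≡ frequencyMoment k xs) →
               Computes {n} {m} algorithm 4 (frequencyMoment k)
    computes m value-moment xs z =
        trans (cong output final) (trans (cong value (decode-encodeWord _)) (value-moment xs))
      , trans (cong proj₂ final) (encode-decode z)
      where
      final : run 4 xs z ≡ (false ∷ false ∷ encodeWord (frequencyMoment k xs · one) , encode (decode z))
      final = trans (cong (run 4 xs) (sym (encode-decode z))) (run-encode xs (decode z))

-- The group of integers modulo `M`.

module Modular (M : ℕ) .{{_ : NonZero M}} where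

  open ≡-Reasoning

  residue : ℕ → Fin M
  residue x = x mod M

  _⊕_ : Fin M → Fin M → Fin M
  i ⊕ j = residue (toℕ i + toℕ j)

  -- For the zero class the difference is `M` itself, hence the reduction.
  ⊖_ : Fin M → Fin M
  ⊖ i = residue (M ∸ toℕ i)

  toℕ-residue : ∀ x → toℕ (residue x) ≡ x % M
  toℕ-residue x = toℕ-fromℕ< (m%n<n x M)

  residue-cong : ∀ {x y} → x % M ≡ y % M → residue x ≡ residue y
  residue-cong {x} {y} eq =
    toℕ-injective (trans (toℕ-residue x) (trans eq (sym (toℕ-residue y))))

  residue-toℕ : ∀ i → residue (toℕ i) ≡ i
  residue-toℕ i = toℕ-injective (trans (toℕ-residue (toℕ i)) (m<n⇒m%n≡m (toℕ<n i)))

  residue-+ : ∀ x y → residue (x + y) ≡ residue x ⊕ residue y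
  residue-+ x y = residue-cong (begin
    (x + y) % M                             ≡⟨ %-distribˡ-+ x y M ⟩
    (x % M + y % M) % M                     ≡⟨ cong₂ (λ a c → (a + c) % M) (toℕ-residue x) (toℕ-residue y) ⟨
    (toℕ (residue x) + toℕ (residue y)) % M ∎)

  ⊕-comm : ∀ i j → i ⊕ j ≡ j ⊕ i
  ⊕-comm i j = cong residue (+-comm (toℕ i) (toℕ j))

  -- Gathers an expression under a single `residue`, so that group laws reduce to arithmetic in ℕ.
  ⊕-residueʳ : ∀ i x → i ⊕ residue x ≡ residue (toℕ i + x)
  ⊕-residueʳ i x = trans (cong (_⊕ residue x) (sym (residue-toℕ i))) (sym (residue-+ (toℕ i) x))

  ⊕-assoc : ∀ i j l → (i ⊕ j) ⊕ l ≡ i ⊕ (j ⊕ l)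
  ⊕-assoc i j l = begin
    (i ⊕ j) ⊕ l                       ≡⟨ ⊕-comm (i ⊕ j) l ⟩
    l ⊕ (i ⊕ j)                       ≡⟨ ⊕-residueʳ l (toℕ i + toℕ j) ⟩
    residue (toℕ l + (toℕ i + toℕ j)) ≡⟨ cong residue (trans (+-comm (toℕ l) _) (+-assoc (toℕ i) _ _)) ⟩
    residue (toℕ i + (toℕ j + toℕ l)) ≡⟨ ⊕-residueʳ i (toℕ j + toℕ l) ⟨
    i ⊕ (j ⊕ l)                       ∎

  ⊕-identityʳ : ∀ i → i ⊕ residue 0 ≡ i
  ⊕-identityʳ i = begin
    i ⊕ residue 0       ≡⟨ ⊕-residueʳ i 0 ⟩
    residue (toℕ i + 0) ≡⟨ cong residue (+-identityʳ (toℕ i)) ⟩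
    residue (toℕ i)     ≡⟨ residue-toℕ i ⟩
    i                   ∎

  ⊕-inverseʳ : ∀ i → i ⊕ (⊖ i) ≡ residue 0
  ⊕-inverseʳ i = begin
    i ⊕ (⊖ i)                   ≡⟨ ⊕-residueʳ i (M ∸ toℕ i) ⟩
    residue (toℕ i + (M ∸ toℕ i)) ≡⟨ cong residue (m+[n∸m]≡n (<⇒≤ (toℕ<n i))) ⟩
    residue M                   ≡⟨ residue-cong (trans (n%n≡0 M) (sym (m*n%n≡0 0 M))) ⟩
    residue 0                   ∎

  isAbelianGroup : IsAbelianGroup _≡_ _⊕_ (residue 0) ⊖_
  isAbelianGroup = record
    { isGroup = record
      { isMonoid = record
        { isSemigroup = record
          { isMagma = record { isEquivalence = isEquivalence ; ∙-cong = cong₂ _⊕_ }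
          ; assoc   = ⊕-assoc
          }
        ; identity = Consequences.comm∧idʳ⇒id ⊕-comm ⊕-identityʳ
        }
      ; inverse = Consequences.comm∧invʳ⇒inv ⊕-comm ⊕-inverseʳ
      ; ⁻¹-cong = cong ⊖_
      }
    ; comm = ⊕-comm
    }

  open Registers isAbelianGroup (residue 1) public using (_·_; module Algorithm)

  ·-residue : ∀ x → x · residue 1 ≡ residue x
  ·-residue zero    = refl
  ·-residue (suc x) = trans (cong (residue 1 ⊕_) (·-residue x)) (sym (residue-+ 1 x))

  -- There is no wrap-around below `M`, so the output is exact and not merely modular.
  toℕ-· : ∀ {x} → x < M → toℕ (x · residue 1) ≡ x
  toℕ-· {x} x<M = trans (cong toℕ (·-residue x)) (trans (toℕ-residue x) (m<n⇒m%n≡m x<M))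

-- Word size and space bounds.

sum-tabulate-≤ : ∀ (f : Fin n → ℕ) {c} → (∀ i → f i ≤ c) → sum (tabulate f) ≤ n * c
sum-tabulate-≤ {zero}  f f≤c = z≤n
sum-tabulate-≤ {suc n} f f≤c = +-mono-≤ (f≤c zero) (sum-tabulate-≤ (f ∘ suc) (f≤c ∘ suc))

-- Otherwise monotonicity of the logarithm would make `⌊log₂ n ⌋` at least its own successor.
n<2^[1+⌊log₂n⌋] : ∀ n → n < 2 ^ suc ⌊log₂ n ⌋
n<2^[1+⌊log₂n⌋] n = ≰⇒> λ 2^l≤n → 1+n≰n
  (subst (_≤ ⌊log₂ n ⌋) (⌊log₂[2^n]⌋≡n (suc ⌊log₂ n ⌋)) (⌊log₂⌋-mono-≤ 2^l≤n))

-- Chosen from F_k ≤ n mᵏ ≤ mᵏ⁺¹: there are `suc k` factors `m`, each below `2 ^ suc ⌊log₂ m ⌋`.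
wordSize : ℕ → ℕ → ℕ
wordSize k m = suc ⌊log₂ m ⌋ * suc k

frequencyMoment<2^wordSize : ∀ k → n ≤ m → (xs : Stream n m) → frequencyMoment k xs < 2 ^ wordSize k m
frequencyMoment<2^wordSize {n} {m} k n≤m xs = begin-strict
  frequencyMoment k xs          ≤⟨ sum-tabulate-≤ (λ i → frequency xs i ^ k)
                                     (λ i → ^-monoˡ-≤ k (count≤n (i ≟_) xs)) ⟩
  n * m ^ k                     ≤⟨ *-monoˡ-≤ (m ^ k) n≤m ⟩
  m ^ suc k                     <⟨ ^-monoˡ-< (suc k) (n<2^[1+⌊log₂n⌋] m) ⟩
  (2 ^ suc ⌊log₂ m ⌋) ^ suc k   ≡⟨ ^-*-assoc 2 (suc ⌊log₂ m ⌋) (suc k) ⟩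
  2 ^ wordSize k m              ∎
  where open ≤-Reasoning

-- Here `l` stands for `⌊log₂ m ⌋` and the summand 2 for the pass counter. Equality at `k = l = 1`
-- fixes the constant 6.
clean-bound : ∀ {k l} → 1 ≤ k → 1 ≤ l → 2 + suc l * suc k ≤ 6 * (k * l)
clean-bound {suc k} {suc l} _ _ = begin
  -- With both variables shifted down by one, the difference of the two sides has nonnegative
  -- coefficients; it is the term added here.
  2 + (2 + l) * (2 + k)                                       ≤⟨ m≤m+n _ _ ⟩
  2 + (2 + l) * (2 + k) + (4 * k + 4 * l + 5 * (k * l))       ≡⟨ identity k l ⟩
  6 * (suc k * suc l)                                         ∎
  where
  open ≤-Reasoning
  identity : ∀ k l → 2 + (2 + l) * (2 + k) + (4 * k + 4 * l + 5 * (k * l)) ≡ 6 * ((1 + k) * (1 + l))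
  identity = solve-∀

-- Each of the three successors is at most twice its argument, whence 8 = 2³.
catalytic-bound : ∀ {k l} n → 1 ≤ k → 1 ≤ l → n * (suc k * (suc l * suc k)) ≤ 8 * (k * k * n * l)
catalytic-bound {k} {l} n 1≤k 1≤l = begin
  n * (suc k * (suc l * suc k))          ≤⟨ *-monoʳ-≤ n (*-mono-≤ (double 1≤k) (*-mono-≤ (double 1≤l) (double 1≤k))) ⟩
  n * ((k + k) * ((l + l) * (k + k)))    ≡⟨ identity k l n ⟩
  8 * (k * k * n * l)                    ∎
  where
  open ≤-Reasoning
  double : ∀ {x} → 1 ≤ x → suc x ≤ x + x
  double {x} 1≤x = +-monoˡ-≤ x 1≤x
  identity : ∀ k l n → n * ((k + k) * ((l + l) * (k + k))) ≡ 8 * (k * k * n * l)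
  identity = solve-∀

-- Short streams and the final statement.

constantAlgorithm : ∀ n → ℕ → CatalyticAlgorithm n
constantAlgorithm n c = record
  { cleanBits     = 0
  ; catalyticBits = 0
  ; onItem        = λ _ s → s
  ; onEndOfPass   = λ s → s
  ; output        = λ _ → c
  }

algorithm : ℕ → (n m : ℕ) → CatalyticAlgorithm n
algorithm k n zero            = constantAlgorithm n n
algorithm k n (suc zero)      = constantAlgorithm n n
algorithm k n m@(suc (suc _)) = Algorithm.algorithm (bits↔Fin (wordSize k m)) toℕ n k
  where
  open Modular (2 ^ wordSize k m) {{m^n≢0 2 (wordSize k m)}}

-- For m ≤ 1 the logarithm vanishes, so no memory is available; then n ≤ m forces F_k = n.
correct : ∀ k → 1 ≤ k → ∀ n m → n ≤ m →
    Computes {n} {m} (algorithm k n m) 4 (frequencyMoment k)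
  × cleanBits (algorithm k n m) ≤ 6 * (k * ⌊log₂ m ⌋)
  × catalyticBits (algorithm k n m) ≤ 8 * (k * k * n * ⌊log₂ m ⌋)
correct k 1≤k zero       zero       _  = (λ { [] [] → refl , refl }) , z≤n , z≤n
correct k 1≤k zero       (suc zero) _  = (λ { (() ∷ _) }) , z≤n , z≤n
correct k 1≤k (suc zero) (suc zero) _  =
  (λ { (zero ∷ []) [] → sym (trans (+-identityʳ (1 ^ k)) (^-zeroˡ k)) , refl }) , z≤n , z≤n
correct k 1≤k (suc (suc n)) (suc zero) (s≤s ())
correct k 1≤k n m@(suc (suc _)) n≤m =
    Algorithm.computes (bits↔Fin (wordSize k m)) toℕ n k m (λ xs → toℕ-· (frequencyMoment<2^wordSize k n≤m xs))
  , clean-bound 1≤k 1≤log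
  , catalytic-bound n 1≤k 1≤log
  where
  open Modular (2 ^ wordSize k m) {{m^n≢0 2 (wordSize k m)}}
  1≤log : 1 ≤ ⌊log₂ m ⌋
  -- Since `m` is at least 2 and log₂ 2 = 1. This lets the bounds absorb the counter bits and the
  -- rounding in the word size.
  1≤log = ⌊log₂⌋-mono-≤ {2} {m} (s≤s (s≤s z≤n))

theorem2 : ∃[ C₁ ] ∃[ C₂ ] ∀ (k : ℕ) → 1 ≤ k →
    Σ[ A ∈ (∀ (n m : ℕ) → CatalyticAlgorithm n) ]
    (∀ (n m : ℕ) → n ≤ m →
    Computes {n} {m} (A n m) 4 (frequencyMoment k)
    × cleanBits (A n m) ≤ C₁ * (k * ⌊log₂ m ⌋)
    × catalyticBits (A n m) ≤ C₂ * (k * k * n * ⌊log₂ m ⌋))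
theorem2 = 6 , 8 , λ k 1≤k → algorithm k , correct k 1≤k
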